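{- For all $q\ge 2$ and $n\in\mathbb{N}$, $\kappa^{\min}_{n,q}\ge \lfloor n/3\rfloor$.
   Context: Let $q\ge 2$, $A=\{0,1,\dots,q-1\}$, $[n]=\{1,\dots,n\}$, and let $F(n,q)$ be the set of all maps $A^n\to A^n$. For $f\in F(m,q)$ and $i\in[m]$, $f_i$ is the $i$-th coordinate function and $f^i(x)=(x_1,\dots,x_{i-1},f_i(x),x_{i+1},\dots,x_m)$; for a word $w=(w_1,\dots,w_t)$ over $[m]$, $f^w=f^{w_t}\circ\cdots\circ f^{w_1}$. $\Pi([m])$ is the set of permutations of $[m]$ written as words $(w_1,\dots,w_m)$. $\mathrm{pr}_{[n]}:A^m\to A^n$ is the projection onto the first $n$ coordinates. For $m\ge n$, $(f,w)$ with $f\in F(m,q)$, $w\in\Pi([m])$ sequentializes $h\in F(n,q)$ if $\mathrm{pr}_{[n]}\circ f^w=h\circ\mathrm{pr}_{[n]}$. $\kappa^{\min}(h)$ is the smallest $k\ge 0$ such that there exist $f\in F(n+k,q)$ and $w\in\Pi([n+k])$ with $(f,w)$ sequentializing $h$, and $\kappa^{\min}_{n,q}=\max\{\kappa^{\min}(h): h\in F(n,q)\}$. -}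

module Defs where

open import Data.Fin using (Fin; _↑ˡ_; _↑ʳ_; splitAt; join)
open import Data.Fin.Properties as Fin
  using (join-splitAt)
open import Data.List as List using (List; []; _∷_)
open import Data.List.Extrema.Nat as Extrema using (argmax)
open import Data.List.Membership.Propositional using (_∈_; lose)
open import Data.List.Membership.Propositional.Properties
  using (∈-cartesianProductWith⁺; ∈-allFin)
open import Data.List.Relation.Unary.All as All using (All)
open import Data.List.Relation.Unary.Any as Any using (here; there)
open import Data.Nat using (ℕ; zero; suc; _+_; _≤_; z≤n; s≤s)
open import Data.Nat.Properties using (≤-trans)
open import Data.Product using (∃; ∃-syntax; _×_; _,_; proj₁; proj₂)
open import Data.Sum using (inj₁; inj₂; [_,_]′; swap)
open import Data.Sum.Properties using (swap-involutive)
open import Data.Vec as Vec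
  using (Vec; []; _∷_; _++_; lookup; _[_]≔_; take; drop; tabulate)
open import Data.Vec.Properties as Vecₚ
  using (≡-dec; []≔-++-↑ˡ; []≔-++-↑ʳ; lookup-++ˡ; lookup-++ʳ; lookup-splitAt;
         lookup∘tabulate; take++drop≡id; ++-injectiveˡ; tabulate-cong)
open import Function using (_∘_; id)
open import Function.Definitions using (Injective; Surjective; Bijective)
open import Level using (Level)
open import Relation.Binary.Definitions using (DecidableEquality)
open import Relation.Binary.PropositionalEquality
  using (_≡_; _≗_; refl; sym; trans; cong; subst; module ≡-Reasoning)
open import Relation.Nullary using (Dec; yes; no; contradiction)
open import Relation.Nullary.Decidable using (map′; _×-dec_; _→-dec_)
open import Relation.Unary using (Pred; Decidable)

private variable
  a p       : Level
  k m n q t : ℕ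

-- The alphabet {0,…,q-1} is Fin q; coordinates are numbered from 0.
F : ℕ → ℕ → Set
F n q = Vec (Fin q) n → Vec (Fin q) n

_⟨_⟩ : F m q → Fin m → F m q
(f ⟨ i ⟩) x = x [ i ]≔ lookup (f x) i

-- The first letter of the word is applied first.
_⟪_⟫ : F m q → Vec (Fin m) t → F m q
f ⟪ []    ⟫ = id
f ⟪ i ∷ w ⟫ = f ⟪ w ⟫ ∘ f ⟨ i ⟩

IsPermutation : Vec (Fin m) m → Set
IsPermutation w = Bijective _≡_ _≡_ (lookup w)

pr : ∀ n {k} → Vec (Fin q) (n + k) → Vec (Fin q) n
pr n = take n

Sequentializes : F (n + k) q → Vec (Fin (n + k)) (n + k) → F n q → Set
Sequentializes {n} f w h = pr n ∘ f ⟪ w ⟫ ≗ h ∘ pr n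

SequentializableWith : F n q → ℕ → Set
SequentializableWith {n} {q} h k =
  ∃[ f ] ∃[ w ] IsPermutation w × Sequentializes {n} {k} {q} f w h

IsLeast : Pred ℕ p → Pred ℕ p
IsLeast P k = P k × (∀ {j} → P j → k ≤ j)

IsGreatest : Pred ℕ p → Pred ℕ p
IsGreatest P k = P k × (∀ {j} → P j → j ≤ k)

-- For the minimum to be a natural number one needs, constructively, that
-- SequentializableWith h is decidable and inhabited; for the maximum over
-- F n q to be one, that F n q is finite up to pointwise equality. Minimum and
-- maximum are abstract: κᵐⁱⁿ-isLeast and κᵐⁱⁿ[,]-isGreatest characterise them.

private

  least : {P : Pred ℕ p} → Decidable P → ∀ b → P b → ∃ (IsLeast P)
  least P? b Pb with P? 0
  ... | yes P0 = 0 , P0 , λ _ → z≤n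
  least P? zero    Pb | no ¬P0 = contradiction Pb ¬P0
  least {P = P} P? (suc b) Pb | no ¬P0 with least (P? ∘ suc) b Pb
  ... | k , Pk , min = suc k , Pk , λ {j} → bound j
    where
    bound : ∀ j → P j → suc k ≤ j
    bound zero    P0 = contradiction P0 ¬P0
    bound (suc j) Pj = s≤s (min Pj)

  vectors : ∀ q n → List (Vec (Fin q) n)
  vectors q zero    = [] ∷ []
  vectors q (suc n) = List.cartesianProductWith _∷_ (List.allFin q) (vectors q n)

  ∈-vectors : (x : Vec (Fin q) n) → x ∈ vectors q n
  ∈-vectors []      = here refl
  ∈-vectors (i ∷ x) = ∈-cartesianProductWith⁺ _∷_ (∈-allFin i) (∈-vectors x)

  module _ {A : Set a} (_≟_ : DecidableEquality A) where

    override : A → A → (A → A) → A → A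
    override x y g z with z ≟ x
    ... | yes _ = y
    ... | no  _ = g z

    -- All self-maps of A that differ from the identity only on xs.
    mapsOn : List A → List A → List (A → A)
    mapsOn ys []       = id ∷ []
    mapsOn ys (x ∷ xs) = List.cartesianProductWith (override x) ys (mapsOn ys xs)

    ∈-mapsOn : ∀ {ys} xs → (∀ y → y ∈ ys) → (f : A → A) →
               ∃[ g ] g ∈ mapsOn ys xs × (∀ {z} → z ∈ xs → g z ≡ f z)
    ∈-mapsOn []       all f = id , here refl , λ ()
    ∈-mapsOn (x ∷ xs) all f with ∈-mapsOn xs all f
    ... | g , g∈ , g≡f =
      override x (f x) g , ∈-cartesianProductWith⁺ (override x) (all (f x)) g∈ , agree
      where
      agree : ∀ {z} → z ∈ x ∷ xs → override x (f x) g z ≡ f z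
      agree {z} z∈ with z ≟ x
      agree z∈          | yes refl = refl
      agree (here z≡x)  | no z≢x   = contradiction z≡x z≢x
      agree (there z∈)  | no z≢x   = g≡f z∈

  functions : ∀ n q → List (F n q)
  functions n q = mapsOn (≡-dec Fin._≟_) (vectors q n) (vectors q n)

  ∈-functions : (f : F n q) → ∃[ g ] g ∈ functions n q × g ≗ f
  ∈-functions {n} {q} f with ∈-mapsOn (≡-dec Fin._≟_) (vectors q n) ∈-vectors f
  ... | g , g∈ , g≡f = g , g∈ , λ x → g≡f (∈-vectors x)

  ∃-dec : {A : Set a} {P : Pred A p} (xs : List A) →
          (∀ {x} → P x → ∃[ y ] y ∈ xs × P y) → Decidable P → Dec (∃ P)
  ∃-dec xs complete P? =
    map′ Any.satisfied (λ (_ , Px) → let _ , y∈ , Py = complete Px in lose y∈ Py)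
         (Any.any? P? xs)

  ⟨⟩-cong : {f g : F m q} → f ≗ g → ∀ i → f ⟨ i ⟩ ≗ g ⟨ i ⟩
  ⟨⟩-cong f≗g i x = cong (λ y → x [ i ]≔ lookup y i) (f≗g x)

  ⟪⟫-cong : {f g : F m q} → f ≗ g → (w : Vec (Fin m) t) → f ⟪ w ⟫ ≗ g ⟪ w ⟫
  ⟪⟫-cong         f≗g []      x = refl
  ⟪⟫-cong {f = f} f≗g (i ∷ w) x =
    trans (cong (f ⟪ w ⟫) (⟨⟩-cong f≗g i x)) (⟪⟫-cong f≗g w _)

  isPermutation? : Decidable (IsPermutation {m})
  isPermutation? w = injective? ×-dec surjective?
    where
    injective? : Dec (Injective _≡_ _≡_ (lookup w))
    injective? =
      map′ (λ inj {i} {j} → inj i j) (λ inj i j → inj)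
        (Fin.all? λ i → Fin.all? λ j →
          (lookup w i Fin.≟ lookup w j) →-dec (i Fin.≟ j))

    surjective? : Dec (Surjective _≡_ _≡_ (lookup w))
    surjective? =
      map′ (λ sur j → proj₁ (sur j) , λ { refl → proj₂ (sur j) })
           (λ sur j → proj₁ (sur j) , proj₂ (sur j) refl)
        (Fin.all? λ j → Fin.any? λ i → lookup w i Fin.≟ j)

  sequentializes? : ∀ (f : F (n + k) q) w h → Dec (Sequentializes {n} {k} f w h)
  sequentializes? {n} {k} {q} f w h =
    map′ (λ eqs x → All.lookup eqs (∈-vectors x)) (λ eq → All.tabulate λ {x} _ → eq x)
      (All.all? (λ x → ≡-dec Fin._≟_ (pr n ((f ⟪ w ⟫) x)) (h (pr n x)))
                (vectors q (n + k)))

  sequentializableWith? : (h : F n q) → Decidable (SequentializableWith h)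
  sequentializableWith? {n} {q} h k =
    ∃-dec (functions (n + k) q)
      (λ {f} (w , perm , seq) → let g , g∈ , g≗f = ∈-functions f in
        g , g∈ , w , perm , λ x → trans (cong (pr n) (⟪⟫-cong g≗f w x)) (seq x))
      (λ f → ∃-dec (vectors (n + k) (n + k))
        (λ {w} Pw → w , ∈-vectors w , Pw)
        (λ w → isPermutation? w ×-dec sequentializes? {n} {k} f w h))

  -- n additional coordinates suffice: store h x in them, then copy it back.
  module Copy {n q} (h : F n q) where

    f : F (n + n) q
    f z = drop n z ++ h (take n z)

    take-++ : (x y : Vec (Fin q) n) → take n (x ++ y) ≡ x
    take-++ x y = ++-injectiveˡ (take n (x ++ y)) x (take++drop≡id n (x ++ y))

    drop-++ : (x y : Vec (Fin q) n) → drop n (x ++ y) ≡ y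
    drop-++ x y = Vecₚ.++-injectiveʳ (take n (x ++ y)) x (take++drop≡id n (x ++ y))

    f-++ : ∀ x y → f (x ++ y) ≡ y ++ h x
    f-++ x y rewrite take-++ x y | drop-++ x y = refl

    -- Overwrite with z the coordinates of y listed in is.
    write : Vec (Fin q) n → Vec (Fin n) t → F n q
    write z []       y = y
    write z (i ∷ is) y = write z is (y [ i ]≔ lookup z i)

    step-↑ʳ : ∀ i x y → (f ⟨ n ↑ʳ i ⟩) (x ++ y) ≡ x ++ (y [ i ]≔ lookup (h x) i)
    step-↑ʳ i x y rewrite f-++ x y | lookup-++ʳ y (h x) i =
      []≔-++-↑ʳ x y i

    step-↑ˡ : ∀ i x y → (f ⟨ i ↑ˡ n ⟩) (x ++ y) ≡ (x [ i ]≔ lookup y i) ++ y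
    step-↑ˡ i x y rewrite f-++ x y | lookup-++ˡ y (h x) i =
      []≔-++-↑ˡ x y i

    run-↑ʳ : (is : Vec (Fin n) t) → ∀ x y →
             (f ⟪ Vec.map (n ↑ʳ_) is ⟫) (x ++ y) ≡ x ++ write (h x) is y
    run-↑ʳ []       x y = refl
    run-↑ʳ (i ∷ is) x y rewrite step-↑ʳ i x y = run-↑ʳ is x _

    run-↑ˡ : (is : Vec (Fin n) t) → ∀ x y →
             (f ⟪ Vec.map (_↑ˡ n) is ⟫) (x ++ y) ≡ write y is x ++ y
    run-↑ˡ []       x y = refl
    run-↑ˡ (i ∷ is) x y rewrite step-↑ˡ i x y = run-↑ˡ is _ y

    run-++ : ∀ {s} (v : Vec (Fin (n + n)) s) (w : Vec (Fin (n + n)) t) →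
             f ⟪ v ++ w ⟫ ≗ f ⟪ w ⟫ ∘ f ⟪ v ⟫
    run-++ []      w x = refl
    run-++ (i ∷ v) w x = run-++ v w _

    write-keeps : ∀ z (is : Vec (Fin n) t) y j → lookup y j ≡ lookup z j →
                  lookup (write z is y) j ≡ lookup z j
    write-keeps z []       y j eq = eq
    write-keeps z (i ∷ is) y j eq = write-keeps z is _ j lemma
      where
      lemma : lookup (y [ i ]≔ lookup z i) j ≡ lookup z j
      lemma with i Fin.≟ j
      ... | yes refl = Vecₚ.lookup∘update i y _
      ... | no  i≢j  = trans (Vecₚ.lookup∘update′ (i≢j ∘ sym) y _) eq

    write-sets : ∀ z (is : Vec (Fin n) t) y s →
                 lookup (write z is y) (lookup is s) ≡ lookup z (lookup is s)
    write-sets z (i ∷ is) y Fin.zero    = write-keeps z is _ i (Vecₚ.lookup∘update i y _)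
    write-sets z (i ∷ is) y (Fin.suc s) = write-sets z is _ s

    write-all : ∀ z y → write z (Vec.allFin n) y ≡ z
    write-all z y = begin
      write z (Vec.allFin n) y                       ≡⟨ Vecₚ.tabulate∘lookup _ ⟨
      tabulate (lookup (write z (Vec.allFin n) y))   ≡⟨ tabulate-cong sets ⟩
      tabulate (lookup z)                            ≡⟨ Vecₚ.tabulate∘lookup z ⟩
      z                                              ∎
      where
      open ≡-Reasoning
      sets : lookup (write z (Vec.allFin n) y) ≗ lookup z
      sets j = subst (λ i → lookup (write z (Vec.allFin n) y) i ≡ lookup z i)
                     (lookup∘tabulate id j) (write-sets z (Vec.allFin n) y j)

    store copy : Vec (Fin (n + n)) n
    store = Vec.map (n ↑ʳ_) (Vec.allFin n)
    copy  = Vec.map (_↑ˡ n) (Vec.allFin n)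

    word : Vec (Fin (n + n)) (n + n)
    word = store ++ copy

    run-word : ∀ x y → (f ⟪ word ⟫) (x ++ y) ≡ h x ++ h x
    run-word x y
      rewrite run-++ store copy (x ++ y)
            | run-↑ʳ (Vec.allFin n) x y | write-all (h x) y
            | run-↑ˡ (Vec.allFin n) x (h x) | write-all (h x) x
      = refl

    sequentializes : Sequentializes {n} {n} f word h
    sequentializes z = begin
      take n ((f ⟪ word ⟫) z)                       ≡⟨ cong (take n ∘ f ⟪ word ⟫) (take++drop≡id n z) ⟨
      take n ((f ⟪ word ⟫) (take n z ++ drop n z))  ≡⟨ cong (take n) (run-word (take n z) (drop n z)) ⟩
      take n (h (take n z) ++ h (take n z))         ≡⟨ take-++ _ _ ⟩
      h (take n z)                                  ∎
      where open ≡-Reasoning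

    σ : Fin (n + n) → Fin (n + n)
    σ i = join n n (swap (splitAt n i))

    σ-involutive : ∀ i → σ (σ i) ≡ i
    σ-involutive i
      rewrite Fin.splitAt-join n n (swap (splitAt n i))
            | swap-involutive (splitAt n i)
      = join-splitAt n n i

    lookup-word : lookup word ≗ σ
    lookup-word i = trans (lookup-splitAt n store copy i) (lemma (splitAt n i))
      where
      lemma : ∀ s → [ lookup store , lookup copy ]′ s ≡ join n n (swap s)
      lemma (inj₁ j) = trans (Vecₚ.lookup-map j _ (Vec.allFin n))
                             (cong (n ↑ʳ_) (lookup∘tabulate id j))
      lemma (inj₂ j) = trans (Vecₚ.lookup-map j _ (Vec.allFin n))
                             (cong (_↑ˡ n) (lookup∘tabulate id j))

    isPermutation : IsPermutation word
    isPermutation = inj , λ j → σ j , λ { refl → trans (lookup-word (σ j)) (σ-involutive j) }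
      where
      inj : Injective _≡_ _≡_ (lookup word)
      inj {i} {j} eq = begin
        i        ≡⟨ σ-involutive i ⟨
        σ (σ i)  ≡⟨ cong σ (trans (sym (lookup-word i)) (trans eq (lookup-word j))) ⟩
        σ (σ j)  ≡⟨ σ-involutive j ⟩
        j        ∎
        where open ≡-Reasoning

abstract

  κᵐⁱⁿ-exists : (h : F n q) → ∃ (IsLeast (SequentializableWith h))
  κᵐⁱⁿ-exists {n} h =
    least (sequentializableWith? h) n
      (Copy.f h , Copy.word h , Copy.isPermutation h , Copy.sequentializes h)

κᵐⁱⁿ : F n q → ℕ
κᵐⁱⁿ h = proj₁ (κᵐⁱⁿ-exists h)

κᵐⁱⁿ-isLeast : (h : F n q) → IsLeast (SequentializableWith h) (κᵐⁱⁿ h)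
κᵐⁱⁿ-isLeast h = proj₂ (κᵐⁱⁿ-exists h)

κᵐⁱⁿ-mono : {h h′ : F n q} → h ≗ h′ → κᵐⁱⁿ h ≤ κᵐⁱⁿ h′
κᵐⁱⁿ-mono {n} {h = h} {h′} h≗h′ with κᵐⁱⁿ-isLeast h′
... | (f , w , perm , seq) , _ =
  proj₂ (κᵐⁱⁿ-isLeast h) (f , w , perm , λ x → trans (seq x) (sym (h≗h′ (pr n x))))

abstract

  κᵐⁱⁿ-max-exists : ∀ n q → ∃ (IsGreatest (λ k → ∃[ h ] κᵐⁱⁿ {n} {q} h ≡ k))
  κᵐⁱⁿ-max-exists n q = κᵐⁱⁿ h₀ , (h₀ , refl) , λ { (h , refl) → bound h }
    where
    h₀ : F n q
    h₀ = argmax κᵐⁱⁿ id (functions n q)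

    all≤ : All (λ g → κᵐⁱⁿ g ≤ κᵐⁱⁿ h₀) (functions n q)
    all≤ = Extrema.f[xs]≤f[argmax] {f = κᵐⁱⁿ {n} {q}} id (functions n q)

    bound : (h : F n q) → κᵐⁱⁿ h ≤ κᵐⁱⁿ h₀
    bound h = let g , g∈ , g≗h = ∈-functions h in
      ≤-trans (κᵐⁱⁿ-mono {h = h} {g} (sym ∘ g≗h)) (All.lookup all≤ g∈)

κᵐⁱⁿ[_,_] : ℕ → ℕ → ℕ
κᵐⁱⁿ[ n , q ] = proj₁ (κᵐⁱⁿ-max-exists n q)

κᵐⁱⁿ[,]-isGreatest : ∀ n q → IsGreatest (λ k → ∃[ h ] κᵐⁱⁿ {n} {q} h ≡ k) κᵐⁱⁿ[ n , q ]
κᵐⁱⁿ[,]-isGreatest n q = proj₂ (κᵐⁱⁿ-max-exists n q)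

{-# OPTIONS --safe #-}
-- Put n = (m + m) + c with m ≤ c and K = q^(m-1).  Call the first m + m
-- coordinates the core.  For each half S of the core, reserve K + 1 points which
-- agree outside S, and let h move their S-part to the rest of the core and write
-- zeros elsewhere.  Greedily, these reserved sets can be made disjoint: fewer than
-- 2^(2m-1) halves have been treated before S, so more than q^(n-1) points are
-- still free, and they fall into only q^(n-m) classes of points agreeing outside S.
-- In any sequentialization of h, stop when exactly half S of the core has been
-- updated.  On the points reserved for S, each of the n coordinates now has a
-- constant value, hence the k additional coordinates determine h: if k < m,
-- two of the K + 1 > q^k reserved points end in the same state, although
-- h is injective on them.

module Submission where

open import Defs
open import Data.Fin as Fin using (Fin; zero; suc; _↑ˡ_; _↑ʳ_; splitAt)
open import Data.Fin.Properties as Finₚ using (any?)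
open import Data.Fin.Subset using (Subset; inside; outside; ∣_∣; ⊥; ⊤)
  renaming (_∈_ to _∈ₛ_; _∉_ to _∉ₛ_)
open import Data.Fin.Subset.Properties using (p⊆q⇒∣p∣≤∣q∣; ∣⊤∣≡n; ∣⊥∣≡0; ∉⊥; ∣p∣≤n)
open import Data.List as List using (List; []; _∷_; length; filter)
open import Data.List.Membership.Propositional using (_∈_; _∉_)
open import Data.List.Membership.Propositional.Properties
  using (∈-allFin; ∈-cartesianProductWith⁺; ∈-map⁺; ∈-++⁺ˡ; ∈-++⁺ʳ; ∈-filter⁻)
open import Data.List.Properties
  using (length-map; length-++; length-take; length-tabulate)
open import Data.List.Relation.Binary.Sublist.Propositional.Properties
  using (length-mono-≤; filter-⊆) renaming (filter⁺ to ⊆-filter⁺)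
open import Data.List.Relation.Unary.All as All using (All; []; _∷_)
open import Data.List.Relation.Unary.All.Properties as Allₚ using (all-filter)
open import Data.List.Relation.Unary.AllPairs using ([]; _∷_)
open import Data.List.Relation.Unary.Any using (here; there)
open import Data.List.Relation.Unary.Unique.Propositional using (Unique)
import Data.List.Relation.Unary.Unique.Propositional.Properties as Uniqueₚ
open import Data.Nat
  using (ℕ; zero; suc; _+_; _*_; _∸_; _^_; _≤_; _<_; _≥_; z≤n; s≤s; s≤s⁻¹; _≤?_; NonZero; >-nonZero)
open import Data.Nat.DivMod using (_/_; m/n*n≤m)
open import Data.Nat.Properties
open import Data.Product using (∃-syntax; _×_; _,_; proj₁; proj₂)
open import Data.Sum using (inj₁; inj₂)
open import Data.Vec as Vec
  using (Vec; []; _∷_; _++_; lookup; _[_]≔_; take; drop; replicate; here; there)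
open import Data.Vec.Membership.Propositional using () renaming (_∈_ to _∈ᵥ_; _∉_ to _∉ᵥ_)
open import Data.Vec.Membership.Propositional.Properties using (∈-lookup)
open import Data.Vec.Properties as Vecₚ using (≡-dec; take++drop≡id)
import Data.Vec.Relation.Binary.Pointwise.Extensional as Pointwise
open import Data.Vec.Relation.Unary.Any as VecAny using (here; there)
import Data.Vec.Relation.Unary.Any.Properties as VecAnyₚ
open import Function using (_∘_; id)
open import Function.Definitions using (Injective)
open import Level using (0ℓ)
open import Relation.Binary.Definitions using (DecidableEquality)
open import Relation.Binary.PropositionalEquality
open import Relation.Nullary using (yes; no; ¬_; ¬?; contradiction)
open import Relation.Unary using (Pred; Decidable)

private variable
  A B C : Set
  a b c d k m n q t K : ℕ

-- Counting in lists

length-filter-¬? : {P : Pred A 0ℓ} (P? : Decidable P) (xs : List A) →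
                   length xs ≡ length (filter P? xs) + length (filter (¬? ∘ P?) xs)
length-filter-¬? P? []       = refl
length-filter-¬? P? (x ∷ xs) with P? x
... | yes _ = cong suc (length-filter-¬? P? xs)
... | no  _ = trans (cong suc (length-filter-¬? P? xs)) (sym (+-suc _ _))

unique-constant⇒length≤1 : {x : A} {xs : List A} → Unique xs → All (_≡ x) xs → length xs ≤ 1
unique-constant⇒length≤1 []                   []                = z≤n
unique-constant⇒length≤1 (_ ∷ [])             (_ ∷ [])          = s≤s z≤n
unique-constant⇒length≤1 ((x≢y ∷ _) ∷ _)      (refl ∷ refl ∷ _) = contradiction refl x≢y

-- Because `ys` has no repetitions, deleting one element of `xs` from it removes at most one entry.
fresh : DecidableEquality A → (xs {ys} : List A) → Unique ys →
        ∃[ zs ] Unique zs × All (_∉ xs) zs × length ys ≤ length zs + length xs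
fresh _≟_ []       {ys} unique = ys , unique , All.tabulate (λ _ ()) , m≤m+n _ 0
fresh _≟_ (x ∷ xs) {ys} unique with fresh _≟_ xs unique
... | zs , unique′ , ∉xs , bound =
  filter (¬? ∘ (_≟ x)) zs , Uniqueₚ.filter⁺ _ unique′ , ∉x∷xs , (begin
    length ys                          ≤⟨ bound ⟩
    length zs + length xs              ≡⟨ cong (_+ length xs) (length-filter-¬? (_≟ x) zs) ⟩
    eq + ne + length xs                ≤⟨ +-monoˡ-≤ (length xs) (+-monoˡ-≤ ne eq≤1) ⟩
    suc (ne + length xs)               ≡⟨ +-suc ne (length xs) ⟨
    ne + suc (length xs)               ∎)
  where
  open ≤-Reasoning
  eq ne : ℕ
  eq = length (filter (_≟ x) zs)
  ne = length (filter (¬? ∘ (_≟ x)) zs)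

  eq≤1 : eq ≤ 1
  eq≤1 = unique-constant⇒length≤1 (Uniqueₚ.filter⁺ (_≟ x) unique′) (all-filter (_≟ x) zs)

  ∉x∷xs : All (_∉ x ∷ xs) (filter (¬? ∘ (_≟ x)) zs)
  ∉x∷xs = All.zipWith
    (λ { (z≢x , z∉) (here z≡x) → z≢x z≡x ; (z≢x , z∉) (there z∈) → z∉ z∈ })
    (all-filter (¬? ∘ (_≟ x)) zs , Allₚ.filter⁺ (¬? ∘ (_≟ x)) ∉xs)

module _ (_≟_ : DecidableEquality B) (label : A → B) where

  -- Induction on the labels: either the class of `t` is already large, or discarding its at most
  -- `K` elements leaves more than `K * length ts` for the remaining labels. A class found among the
  -- rest is a sublist of the same class in `xs`.
  pigeonhole : ∀ ts xs → All (λ x → label x ∈ ts) xs → K * length ts < length xs →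
               ∃[ t ] K < length (filter (λ x → label x ≟ t) xs)
  pigeonhole {K} [] [] _ lt = contradiction lt λ ()
  pigeonhole {K} [] (x ∷ xs) (() ∷ _) lt
  pigeonhole {K} (t ∷ ts) xs ∈ts lt with suc K ≤? length (filter (λ x → label x ≟ t) xs)
  ... | yes heavy = t , heavy
  ... | no ¬heavy =
    let t′ , heavy = pigeonhole ts rest rest∈ts rest-long
    in  t′ , <-≤-trans heavy
               (length-mono-≤ (⊆-filter⁺ _ _ (λ { refl → id }) (filter-⊆ other? xs)))
    where
    other? : Decidable (λ x → label x ≢ t)
    other? x = ¬? (label x ≟ t)

    rest : List A
    rest = filter other? xs

    rest∈ts : All (λ x → label x ∈ ts) rest
    rest∈ts = All.zipWith
      (λ { (≢t , here ≡t) → contradiction ≡t ≢t ; (≢t , there ∈ts) → ∈ts })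
      (all-filter other? xs , Allₚ.filter⁺ other? ∈ts)

    rest-long : K * length ts < length rest
    rest-long = +-cancelˡ-< K _ _ (begin-strict
      K + K * length ts  ≡⟨ *-suc K (length ts) ⟨
      K * suc (length ts) <⟨ lt ⟩
      length xs           ≡⟨ length-filter-¬? (λ x → label x ≟ t) xs ⟩
      _ + length rest     ≤⟨ +-monoˡ-≤ (length rest) (s≤s⁻¹ (≰⇒> ¬heavy)) ⟩
      K + length rest     ∎)
      where open ≤-Reasoning

-- Enumeration of all words of a given length

length-cartesianProductWith : (f : A → B → C) → ∀ xs ys →
  length (List.cartesianProductWith f xs ys) ≡ length xs * length ys
length-cartesianProductWith f []       ys = refl
length-cartesianProductWith f (x ∷ xs) ys = trans (length-++ (List.map (f x) ys))
  (cong₂ _+_ (length-map (f x) ys) (length-cartesianProductWith f xs ys))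

words : ∀ q n → List (Vec (Fin q) n)
words q zero    = [] ∷ []
words q (suc n) = List.cartesianProductWith _∷_ (List.allFin q) (words q n)

length-words : ∀ q n → length (words q n) ≡ q ^ n
length-words q zero    = refl
length-words q (suc n) = trans (length-cartesianProductWith _∷_ (List.allFin q) (words q n))
  (cong₂ _*_ (length-tabulate {n = q} id) (length-words q n))

∈-words : (x : Vec (Fin q) n) → x ∈ words q n
∈-words []      = here refl
∈-words (i ∷ x) = ∈-cartesianProductWith⁺ _∷_ (∈-allFin i) (∈-words x)

words-unique : ∀ q n → Unique (words q n)
words-unique q zero    = [] ∷ []
words-unique q (suc n) =
  Uniqueₚ.cartesianProductWith⁺ _∷_ Vecₚ.∷-injective (Uniqueₚ.allFin⁺ q) (words-unique q n)

_≟ᵥ_ : DecidableEquality (Vec (Fin q) n)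
_≟ᵥ_ = ≡-dec Finₚ._≟_

-- Greedy choice of disjoint sets of points

module Greedy
  {Task : Set} (_≟ᴮ_ : DecidableEquality B) (_≟ᴬ_ : DecidableEquality A)
  (label : Task → A → B) (target : Task → A → C) (default : A → C)
  {ts : List B} (∈-ts : ∀ t → t ∈ ts)
  {universe : List A} (unique : Unique universe) (K : ℕ)
  where

  open import Data.List.Membership.DecPropositional _≟ᴬ_ using (_∈?_)

  -- Disjointness for different tasks is not recorded here: it serves to build a single `h` that is
  -- on target for all of them at once.
  record Reserved (h : A → C) (s : Task) : Set where
    field
      points     : List A
      distinct   : Unique points
      size       : length points ≡ suc K
      class      : B
      same-label : All (λ x → label s x ≡ class) points
      on-target  : All (λ x → h x ≡ target s x) points

  open Reserved

  -- The list `used` collects the points on which `h` is already final. It is short enough that a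
  -- new task still finds a large label class among the other points, and redefining `h` off `used`
  -- preserves all earlier reservations.
  reserve : ∀ ss → K * length ts + length ss * suc K ≤ length universe →
            ∃[ h ] ∃[ used ] length used ≤ length ss * suc K ×
              All (λ s → ∃[ r ] All (_∈ used) (points {h} {s} r)) ss
  reserve []       _     = default , [] , z≤n , []
  reserve (s ∷ ss) bound
    with reserve ss (≤-trans (+-monoʳ-≤ (K * length ts) (m≤n+m _ (suc K))) bound)
  ... | h , used , used≤ , rs with fresh _≟ᴬ_ used unique
  ... | zs , zs-unique , zs∉used , universe≤
    with pigeonhole _≟ᴮ_ (label s) ts zs (All.tabulate λ _ → ∈-ts _) many-fresh
    where
    -- The hypothesis budgets `suc K` points for each task including `s`, while `used` only spends
    -- those of `ss`; the difference gives the strict inequality.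
    many-fresh : K * length ts < length zs
    many-fresh = ≤-trans (≤-trans (s≤s (m≤m+n _ K)) (≤-reflexive (sym (+-suc _ K))))
      (+-cancelʳ-≤ (length ss * suc K) (K * length ts + suc K) (length zs) (begin
        K * length ts + suc K + length ss * suc K   ≡⟨ +-assoc (K * length ts) (suc K) _ ⟩
        K * length ts + suc (length ss) * suc K     ≤⟨ bound ⟩
        length universe                             ≤⟨ universe≤ ⟩
        length zs + length used                     ≤⟨ +-monoʳ-≤ (length zs) used≤ ⟩
        length zs + length ss * suc K               ∎))
      where open ≤-Reasoning
  ... | t , heavy = h′ , new List.++ used , used′≤ , new-reserved ∷ All.map keep rs
    where
    in-class? : Decidable (λ x → label s x ≡ t)
    in-class? x = label s x ≟ᴮ t

    -- Truncating the class to exactly `suc K` points keeps the new used list within budget.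
    new : List A
    new = List.take (suc K) (filter in-class? zs)

    new-size : length new ≡ suc K
    new-size = trans (length-take (suc K) (filter in-class? zs)) (m≤n⇒m⊓n≡m heavy)

    new∉used : All (_∉ used) new
    new∉used = Allₚ.take⁺ (suc K) (Allₚ.filter⁺ in-class? zs∉used)

    -- Outside `used`, `target s` is taken everywhere, not just on `new`; tasks treated afterwards
    -- overwrite it off the enlarged used list.
    h′ : A → C
    h′ x with x ∈? used
    ... | yes _ = h x
    ... | no  _ = target s x

    h′-used : ∀ {x} → x ∈ used → h′ x ≡ h x
    h′-used {x} x∈ with x ∈? used
    ... | yes _ = refl
    ... | no x∉ = contradiction x∈ x∉

    h′-fresh : ∀ {x} → x ∉ used → h′ x ≡ target s x
    h′-fresh {x} x∉ with x ∈? used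
    ... | yes x∈ = contradiction x∈ x∉
    ... | no _   = refl

    used′≤ : length (new List.++ used) ≤ suc (length ss) * suc K
    used′≤ = ≤-trans (≤-reflexive (length-++ new)) (+-mono-≤ (≤-reflexive new-size) used≤)

    new-reserved : ∃[ r ] All (_∈ new List.++ used) (points {h′} {s} r)
    new-reserved = record
      { points     = new
      ; distinct   = Uniqueₚ.take⁺ (suc K) (Uniqueₚ.filter⁺ in-class? zs-unique)
      ; size       = new-size
      ; class      = t
      ; same-label = Allₚ.take⁺ (suc K) (all-filter in-class? zs)
      ; on-target  = All.map h′-fresh new∉used
      } , All.tabulate ∈-++⁺ˡ

    keep : ∀ {s} → ∃[ r ] All (_∈ used) (points {h} {s} r) →
           ∃[ r ] All (_∈ new List.++ used) (points {h′} {s} r)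
    keep (r , ∈used) = record
      { points     = points r
      ; distinct   = distinct r
      ; size       = size r
      ; class      = class r
      ; same-label = same-label r
      ; on-target  = All.zipWith (λ (x∈ , eq) → trans (h′-used x∈) eq) (∈used , on-target r)
      } , All.map (∈-++⁺ʳ new) ∈used

-- A cut marks each of d core coordinates as kept (not yet updated) or written.

data Cut : ℕ → ℕ → ℕ → Set where
  []    : Cut 0 0 0
  keep  : Cut a b d → Cut (suc a) b (suc d)
  write : Cut a b d → Cut a (suc b) (suc d)

kept : Cut a b d → Subset d
kept []        = []
kept (keep s)  = inside ∷ kept s
kept (write s) = outside ∷ kept s

merge : Cut a b d → Vec A a → Vec A b → Vec A d
merge []        []      []      = []
merge (keep s)  (x ∷ u) v       = x ∷ merge s u v
merge (write s) u       (x ∷ v) = x ∷ merge s u v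

keptPart : Cut a b d → Vec A d → Vec A a
keptPart []        []      = []
keptPart (keep s)  (x ∷ z) = x ∷ keptPart s z
keptPart (write s) (x ∷ z) = keptPart s z

writtenPart : Cut a b d → Vec A d → Vec A b
writtenPart []        []      = []
writtenPart (keep s)  (x ∷ z) = writtenPart s z
writtenPart (write s) (x ∷ z) = x ∷ writtenPart s z

merge-parts : (s : Cut a b d) (z : Vec A d) → merge s (keptPart s z) (writtenPart s z) ≡ z
merge-parts []        []      = refl
merge-parts (keep s)  (x ∷ z) = cong (x ∷_) (merge-parts s z)
merge-parts (write s) (x ∷ z) = cong (x ∷_) (merge-parts s z)

keptPart-merge : (s : Cut a b d) (u : Vec A a) (v : Vec A b) → keptPart s (merge s u v) ≡ u
keptPart-merge []        []      []      = refl
keptPart-merge (keep s)  (x ∷ u) v       = cong (x ∷_) (keptPart-merge s u v)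
keptPart-merge (write s) u       (x ∷ v) = keptPart-merge s u v

lookup-kept : ∀ (s : Cut a b d) (x y : Vec A d) {i} → i ∈ₛ kept s →
              keptPart s x ≡ keptPart s y → lookup x i ≡ lookup y i
lookup-kept (keep s)  (_ ∷ x) (_ ∷ y) here       eq = Vecₚ.∷-injectiveˡ eq
lookup-kept (keep s)  (_ ∷ x) (_ ∷ y) (there i∈) eq = lookup-kept s x y i∈ (Vecₚ.∷-injectiveʳ eq)
lookup-kept (write s) (_ ∷ x) (_ ∷ y) (there i∈) eq = lookup-kept s x y i∈ eq

lookup-written : ∀ (s : Cut a b d) (u u′ : Vec A a) (v : Vec A b) {i} → i ∉ₛ kept s →
                 lookup (merge s u v) i ≡ lookup (merge s u′ v) i
lookup-written (keep s)  _       _        _       {zero}  i∉ = contradiction here i∉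
lookup-written (keep s)  (_ ∷ u) (_ ∷ u′) v       {suc i} i∉ = lookup-written s u u′ v (i∉ ∘ there)
lookup-written (write s) _       _        (_ ∷ _) {zero}  i∉ = refl
lookup-written (write s) u       u′       (_ ∷ v) {suc i} i∉ = lookup-written s u u′ v (i∉ ∘ there)

-- Turns the set of pending core coordinates found at a stopping time into one of the enumerated
-- cuts.
fromSubset : ∀ a b (p : Subset d) → a + b ≡ d → ∣ p ∣ ≡ a → ∃[ s ] kept {a} {b} s ≡ p
fromSubset zero    zero    []            _  _ = [] , refl
fromSubset (suc a) b       (inside ∷ p)  eq ∣p∣ =
  let s , s≡p = fromSubset a b p (suc-injective eq) (suc-injective ∣p∣)
  in  keep s , cong (inside ∷_) s≡p
fromSubset a       (suc b) (outside ∷ p) eq ∣p∣ =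
  let s , s≡p = fromSubset a b p (suc-injective (trans (sym (+-suc a b)) eq)) ∣p∣
  in  write s , cong (outside ∷_) s≡p
-- With nothing left to write, `a` is `suc d`, too many elements for `p`, a subset of `d`
-- coordinates.
fromSubset a       zero    (outside ∷ p) eq ∣p∣ = contradiction
  (≤-trans (≤-reflexive (trans (sym eq) (trans (+-identityʳ a) (sym ∣p∣)))) (∣p∣≤n p))
  1+n≰n

-- Pascal's recursion: the number of entries is the binomial coefficient of `d` over `a` if `a + b`
-- equals `d`, and zero otherwise.
cuts cuts-keep cuts-write : ∀ d a b → List (Cut a b d)

cuts zero    zero    zero    = [] ∷ []
cuts zero    zero    (suc b) = []
cuts zero    (suc a) b       = []
cuts (suc d) a       b       = cuts-keep (suc d) a b List.++ cuts-write (suc d) a b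

cuts-keep (suc d) (suc a) b = List.map keep (cuts d a b)
cuts-keep _       _       _ = []

cuts-write (suc d) a (suc b) = List.map write (cuts d a b)
cuts-write _       _ _       = []

∈-cuts : (s : Cut a b d) → s ∈ cuts d a b
∈-cuts []                    = here refl
∈-cuts (keep s)              = ∈-++⁺ˡ (∈-map⁺ keep (∈-cuts s))
∈-cuts (write {a} {b} {d} s) =
  ∈-++⁺ʳ (cuts-keep (suc d) a (suc b)) (∈-map⁺ write (∈-cuts s))

-- Pascal's rule doubles the bound at each step, starting from at most one cut of a single
-- coordinate. The factor 2 saved against counting all subsets later absorbs the successor in
-- `suc (q ^ m)`.
length-cuts : ∀ d a b → length (cuts (suc d) a b) ≤ 2 ^ d
length-cuts zero zero          zero          = z≤n
length-cuts zero zero          (suc zero)    = s≤s z≤n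
length-cuts zero zero          (suc (suc b)) = z≤n
length-cuts zero (suc zero)    zero          = s≤s z≤n
length-cuts zero (suc zero)    (suc b)       = z≤n
length-cuts zero (suc (suc a)) zero          = z≤n
length-cuts zero (suc (suc a)) (suc b)       = z≤n
length-cuts (suc d) a b = begin
  length (cuts-keep (2 + d) a b List.++ cuts-write (2 + d) a b)
    ≡⟨ length-++ (cuts-keep (2 + d) a b) ⟩
  length (cuts-keep (2 + d) a b) + length (cuts-write (2 + d) a b)
    ≤⟨ +-mono-≤ (keep≤ a b) (write≤ a b) ⟩
  2 ^ d + 2 ^ d
    ≡⟨ cong (2 ^ d +_) (+-identityʳ (2 ^ d)) ⟨
  2 ^ suc d ∎
  where
  open ≤-Reasoning
  keep≤ : ∀ a b → length (cuts-keep (2 + d) a b) ≤ 2 ^ d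
  keep≤ zero    b = z≤n
  keep≤ (suc a) b = ≤-trans (≤-reflexive (length-map keep (cuts (suc d) a b))) (length-cuts d a b)

  write≤ : ∀ a b → length (cuts-write (2 + d) a b) ≤ 2 ^ d
  write≤ a zero    = z≤n
  write≤ a (suc b) = ≤-trans (≤-reflexive (length-map write (cuts (suc d) a b))) (length-cuts d a b)

-- Updates along a word

∣p[i]≔inside∣≤1+∣p∣ : ∀ (p : Subset d) i → ∣ p [ i ]≔ inside ∣ ≤ suc ∣ p ∣
∣p[i]≔inside∣≤1+∣p∣ (inside  ∷ p) zero    = n≤1+n _
∣p[i]≔inside∣≤1+∣p∣ (outside ∷ p) zero    = ≤-refl
∣p[i]≔inside∣≤1+∣p∣ (inside  ∷ p) (suc i) = s≤s (∣p[i]≔inside∣≤1+∣p∣ p i)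
∣p[i]≔inside∣≤1+∣p∣ (outside ∷ p) (suc i) = ∣p[i]≔inside∣≤1+∣p∣ p i

module _ (e : Fin d → Fin n) where

  occurring : Vec (Fin n) t → Subset d
  occurring []      = ⊥
  occurring (j ∷ w) with any? (λ i → e i Finₚ.≟ j)
  ... | yes (i , _) = occurring w [ i ]≔ inside
  ... | no  _       = occurring w

  ∣occurring∣-∷ : ∀ j (w : Vec (Fin n) t) → ∣ occurring (j ∷ w) ∣ ≤ suc ∣ occurring w ∣
  ∣occurring∣-∷ j w with any? (λ i → e i Finₚ.≟ j)
  ... | yes (i , _) = ∣p[i]≔inside∣≤1+∣p∣ (occurring w) i
  ... | no  _       = n≤1+n _

  ∈-occurring⁻ : ∀ (w : Vec (Fin n) t) {i} → i ∈ₛ occurring w → e i ∈ᵥ w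
  ∈-occurring⁻ []      i∈ = contradiction i∈ ∉⊥
  ∈-occurring⁻ (j ∷ w) {i} i∈ with any? (λ i → e i Finₚ.≟ j)
  ... | no _ = there (∈-occurring⁻ w i∈)
  ... | yes (i′ , ei′≡j) with i Finₚ.≟ i′
  ... | yes refl = here ei′≡j
  ... | no i≢i′  = there (∈-occurring⁻ w (Vecₚ.lookup⇒[]= i _
        (trans (sym (Vecₚ.lookup∘update′ i≢i′ (occurring w) inside)) (Vecₚ.[]=⇒lookup i∈))))

  module _ (e-injective : Injective _≡_ _≡_ e) where

    -- Each letter marks only one preimage under `e`; by injectivity there is no other.
    ∈-occurring⁺ : ∀ (w : Vec (Fin n) t) {i} → e i ∈ᵥ w → i ∈ₛ occurring w
    ∈-occurring⁺ (j ∷ w) {i} ei∈ with any? (λ i → e i Finₚ.≟ j) | ei∈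
    ... | no ∄i          | here ei≡j  = contradiction (i , ei≡j) ∄i
    ... | no _           | there ei∈w = ∈-occurring⁺ w ei∈w
    ... | yes (i′ , ei′≡j) | ei∈ with i Finₚ.≟ i′ | ei∈
    ... | yes refl | _          = Vecₚ.[]≔-updates (occurring w) i
    ... | no i≢i′  | here ei≡j  = contradiction (e-injective (trans ei≡j (sym ei′≡j))) i≢i′
    ... | no i≢i′  | there ei∈w =
      Vecₚ.[]≔-minimal (occurring w) i i′ i≢i′ (∈-occurring⁺ w ei∈w)

  -- Indexing by `v ++ w` lets a pattern match replace the word by its two phases; `w` is the phase
  -- still to be run.
  data Stop (m : ℕ) : Vec (Fin n) t → Set where
    stop : (v : Vec (Fin n) a) (w : Vec (Fin n) b) → ∣ occurring w ∣ ≡ m → Stop m (v ++ w)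

  -- Discrete intermediate values: dropping the first letter lowers the count by at most one, and
  -- the empty word has count zero, so no value in between is skipped.
  stop-at : ∀ m (w : Vec (Fin n) t) → m ≤ ∣ occurring w ∣ → Stop m w
  stop-at m []      m≤ = stop [] [] (≤-antisym (≤-trans (≤-reflexive (∣⊥∣≡0 d)) z≤n) m≤)
  stop-at m (j ∷ w) m≤ with m ≤? ∣ occurring w ∣
  ... | no m≰ = stop [] (j ∷ w) (≤-antisym (≤-trans (∣occurring∣-∷ j w) (≰⇒> m≰)) m≤)
  ... | yes m≤w with stop-at m w m≤w
  ... | stop v w eq = stop (j ∷ v) w eq

-- Running a word in two phases

⟪⟫-++ : ∀ (f : F n q) (v : Vec (Fin n) a) (w : Vec (Fin n) b) x →
        (f ⟪ v ++ w ⟫) x ≡ (f ⟪ w ⟫) ((f ⟪ v ⟫) x)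
⟪⟫-++ f []      w x = refl
⟪⟫-++ f (i ∷ v) w x = ⟪⟫-++ f v w _

lookup-⟪⟫-∉ : ∀ (f : F n q) (w : Vec (Fin n) t) x {i} → i ∉ᵥ w →
              lookup ((f ⟪ w ⟫) x) i ≡ lookup x i
lookup-⟪⟫-∉ f []      x i∉ = refl
lookup-⟪⟫-∉ f (j ∷ w) x i∉ = trans (lookup-⟪⟫-∉ f w _ (i∉ ∘ there))
  (Vecₚ.lookup∘update′ (i∉ ∘ here) x _)

take-++ : (x : Vec A n) (y : Vec A k) → take n (x ++ y) ≡ x
take-++ []      y = refl
take-++ (a ∷ x) y = cong (a ∷_) (take-++ x y)

lookup-take : ∀ n (x : Vec A (n + k)) i → lookup (take n x) i ≡ lookup x (i ↑ˡ k)
lookup-take (suc n) (a ∷ x) zero    = refl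
lookup-take (suc n) (a ∷ x) (suc i) = lookup-take n x i

lookup-drop : ∀ n (x : Vec A (n + k)) i → lookup x (n ↑ʳ i) ≡ lookup (drop n x) i
lookup-drop zero    x       i = refl
lookup-drop (suc n) (a ∷ x) i = lookup-drop n x i

lookup-extensional : {x y : Vec A n} → (∀ i → lookup x i ≡ lookup y i) → x ≡ y
lookup-extensional eq = Pointwise.Pointwise-≡⇒≡ (Pointwise.ext eq)

-- A common letter would stand at two different positions of the concatenation.
++-disjoint : (v : Vec A a) (w : Vec A b) → Injective _≡_ _≡_ (lookup (v ++ w)) →
              ∀ {x} → x ∈ᵥ w → x ∉ᵥ v
++-disjoint {a = a} {b} v w inj {x} x∈w x∈v = absurd (trans (sym (Finₚ.splitAt-↑ˡ a _ b))
  (trans (cong (splitAt a) same) (Finₚ.splitAt-↑ʳ a b _)))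
  where
  same : VecAny.index x∈v ↑ˡ b ≡ a ↑ʳ VecAny.index x∈w
  same = inj (begin
    lookup (v ++ w) (VecAny.index x∈v ↑ˡ b)  ≡⟨ Vecₚ.lookup-++ˡ v w _ ⟩
    lookup v (VecAny.index x∈v)              ≡⟨ VecAnyₚ.lookup-index x∈v ⟨
    x                                        ≡⟨ VecAnyₚ.lookup-index x∈w ⟩
    lookup w (VecAny.index x∈w)              ≡⟨ Vecₚ.lookup-++ʳ v w _ ⟨
    lookup (v ++ w) (a ↑ʳ VecAny.index x∈w)  ∎)
    where open ≡-Reasoning

  absurd : ∀ {i : Fin a} {j : Fin b} → inj₁ i ≢ inj₂ j
  absurd ()

module _ {h : F n q} {f : F (n + k) q} (v : Vec (Fin (n + k)) a) (w : Vec (Fin (n + k)) b)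
         (disjoint : ∀ {j} → j ∈ᵥ w → j ∉ᵥ v)
         (seq : (λ x → take n ((f ⟪ v ++ w ⟫) x)) ≗ h ∘ take n)
         (z : Vec (Fin q) k)
  where

  open import Data.Vec.Membership.DecPropositional (Finₚ._≟_ {n + k})
    using () renaming (_∈?_ to _∈ᵥ?_)

  state : Vec (Fin q) n → Vec (Fin q) (n + k)
  state x = (f ⟪ v ⟫) (x ++ z)

  h-state : ∀ x → h x ≡ take n ((f ⟪ w ⟫) (state x))
  h-state x = begin
    h x                                 ≡⟨ cong h (take-++ x z) ⟨
    h (take n (x ++ z))                 ≡⟨ seq (x ++ z) ⟨
    take n ((f ⟪ v ++ w ⟫) (x ++ z))    ≡⟨ cong (take n) (⟪⟫-++ f v w (x ++ z)) ⟩
    take n ((f ⟪ w ⟫) (state x))        ∎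
    where open ≡-Reasoning

  lookup-pending : ∀ x i → i ↑ˡ k ∈ᵥ w → lookup (state x) (i ↑ˡ k) ≡ lookup x i
  lookup-pending x i i∈ = trans (lookup-⟪⟫-∉ f v (x ++ z) (disjoint i∈)) (Vecₚ.lookup-++ˡ x z i)

  -- The second phase never touches such a coordinate, so it must already carry its final value.
  lookup-done : ∀ x i → i ↑ˡ k ∉ᵥ w → lookup (state x) (i ↑ˡ k) ≡ lookup (h x) i
  lookup-done x i i∉ = begin
    lookup (state x) (i ↑ˡ k)                 ≡⟨ lookup-⟪⟫-∉ f w (state x) i∉ ⟨
    lookup ((f ⟪ w ⟫) (state x)) (i ↑ˡ k)     ≡⟨ lookup-take n _ i ⟨
    lookup (take n ((f ⟪ w ⟫) (state x))) i   ≡⟨ cong (λ y → lookup y i) (h-state x) ⟨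
    lookup (h x) i                            ∎
    where open ≡-Reasoning

  -- Pending coordinates still show the input and finished ones already show the output, so the
  -- hypotheses make the two intermediate states equal; the second phase then gives equal results.
  h-determined : ∀ x y →
    (∀ i → i ↑ˡ k ∈ᵥ w → lookup x i ≡ lookup y i) →
    (∀ i → i ↑ˡ k ∉ᵥ w → lookup (h x) i ≡ lookup (h y) i) →
    drop n (state x) ≡ drop n (state y) → h x ≡ h y
  h-determined x y pending done eq =
    trans (h-state x) (trans (cong (take n ∘ f ⟪ w ⟫) state≡) (sym (h-state y)))
    where
    take≡ : ∀ i → lookup (take n (state x)) i ≡ lookup (take n (state y)) i
    take≡ i = trans (lookup-take n (state x) i) (trans step (sym (lookup-take n (state y) i)))
      where
      step : lookup (state x) (i ↑ˡ k) ≡ lookup (state y) (i ↑ˡ k)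
      step with (i ↑ˡ k) ∈ᵥ? w
      ... | yes i∈ = trans (lookup-pending x i i∈) (trans (pending i i∈) (sym (lookup-pending y i i∈)))
      ... | no i∉  = trans (lookup-done x i i∉) (trans (done i i∉) (sym (lookup-done y i i∉)))

    state≡ : state x ≡ state y
    state≡ = begin
      state x                                ≡⟨ take++drop≡id n (state x) ⟨
      take n (state x) ++ drop n (state x)   ≡⟨ cong₂ _++_ (lookup-extensional take≡) eq ⟩
      take n (state y) ++ drop n (state y)   ≡⟨ take++drop≡id n (state y) ⟩
      state y                                ∎
      where open ≡-Reasoning

↑-elim : ∀ m (P : Fin (m + n) → Set) → (∀ i → P (i ↑ˡ n)) → (∀ j → P (m ↑ʳ j)) → ∀ i → P i
↑-elim {n} m P P↑ˡ P↑ʳ i = subst P (Finₚ.join-splitAt m n i) (P-join (splitAt m i))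
  where
  P-join : ∀ j → P (Fin.join m n j)
  P-join (inj₁ j) = P↑ˡ j
  P-join (inj₂ j) = P↑ʳ j

two-distinct : {xs : List A} → Unique xs → 1 < length xs → ∃[ x ] ∃[ y ] x ∈ xs × y ∈ xs × x ≢ y
two-distinct {xs = x ∷ y ∷ xs} ((x≢y ∷ _) ∷ _) _ = x , y , here refl , there (here refl) , x≢y
two-distinct {xs = _ ∷ []} _ (s≤s ())

-- The hard function built from the halves of the core

module Construction (o : Fin q) (m c : ℕ) where

  core : ℕ
  core = m + m

  -- Both halves have size `m`, so the written part fits exactly onto the kept coordinates. Once the
  -- written half shows `o`, the data still to be output there must be stored outside the core.
  target : Cut m m core → F (core + c) q
  target s x = merge s (writtenPart s (take core x)) (replicate m o) ++ replicate c o

  -- Includes the last `c` coordinates: within a class their inputs are constant, and so are their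
  -- outputs under `target`, whether or not they have been updated.
  label : Cut m m core → Vec (Fin q) (core + c) → Vec (Fin q) (m + c)
  label s x = keptPart s (take core x) ++ drop core x

  open Greedy _≟ᵥ_ _≟ᵥ_ label target id ∈-words (words-unique q (core + c)) public

  module _ (s : Cut m m core) {x y : Vec (Fin q) (core + c)}
           (same-label : label s x ≡ label s y)
    where

    keptPart≡ : keptPart s (take core x) ≡ keptPart s (take core y)
    keptPart≡ = Vecₚ.++-injectiveˡ _ _ same-label

    drop≡ : drop core x ≡ drop core y
    drop≡ = Vecₚ.++-injectiveʳ (keptPart s (take core x)) _ same-label

    -- The written part can be read off the kept coordinates of the image, and the label supplies
    -- everything else.
    target-injective : target s x ≡ target s y → x ≡ y
    target-injective eq = begin
      x                            ≡⟨ take++drop≡id core x ⟨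
      take core x ++ drop core x   ≡⟨ cong₂ _++_ take≡ drop≡ ⟩
      take core y ++ drop core y   ≡⟨ take++drop≡id core y ⟩
      y                            ∎
      where
      open ≡-Reasoning

      writtenPart≡ : writtenPart s (take core x) ≡ writtenPart s (take core y)
      writtenPart≡ = begin
        writtenPart s (take core x)
          ≡⟨ keptPart-merge s _ (replicate m o) ⟨
        keptPart s (merge s (writtenPart s (take core x)) (replicate m o))
          ≡⟨ cong (keptPart s) (Vecₚ.++-injectiveˡ (merge s _ _) _ eq) ⟩
        keptPart s (merge s (writtenPart s (take core y)) (replicate m o))
          ≡⟨ keptPart-merge s _ (replicate m o) ⟩
        writtenPart s (take core y) ∎

      take≡ : take core x ≡ take core y
      take≡ = begin
        take core x
          ≡⟨ merge-parts s (take core x) ⟨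
        merge s (keptPart s (take core x)) (writtenPart s (take core x))
          ≡⟨ cong₂ (merge s) keptPart≡ writtenPart≡ ⟩
        merge s (keptPart s (take core y)) (writtenPart s (take core y))
          ≡⟨ merge-parts s (take core y) ⟩
        take core y ∎

    -- The premise constrains `i` only if it lies in the core; elsewhere the label gives the
    -- equality.
    same-kept : ∀ i → (∀ j → i ≡ j ↑ˡ c → j ∈ₛ kept s) → lookup x i ≡ lookup y i
    same-kept = ↑-elim core _
      (λ j j∈ → trans (sym (lookup-take core x j))
        (trans (lookup-kept s (take core x) (take core y) (j∈ j refl) keptPart≡)
               (lookup-take core y j)))
      (λ j _ → trans (lookup-drop core x j)
        (trans (cong (λ z → lookup z j) drop≡) (sym (lookup-drop core y j))))

    same-written : ∀ i → (∀ j → i ≡ j ↑ˡ c → j ∉ₛ kept s) →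
                   lookup (target s x) i ≡ lookup (target s y) i
    same-written = ↑-elim core _
      (λ j j∉ → trans (Vecₚ.lookup-++ˡ (merge s _ _) _ j)
        (trans (lookup-written s _ _ (replicate m o) (j∉ j refl))
               (sym (Vecₚ.lookup-++ˡ (merge s _ _) _ j))))
      (λ j _ → trans (Vecₚ.lookup-++ʳ (merge s _ _) (replicate c o) j)
        (sym (Vecₚ.lookup-++ʳ (merge s _ _) (replicate c o) j)))

  module _ {K} {h : F (core + c) q} (reserved : ∀ s → Reserved K h s)
           (f : F (core + c + k) q) where

    e : Fin core → Fin (core + c + k)
    e i = (i ↑ˡ c) ↑ˡ k

    e-injective : Injective _≡_ _≡_ e
    e-injective eq = Finₚ.↑ˡ-injective c _ _ (Finₚ.↑ˡ-injective k _ _ eq)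

    reserved-bound : (w : Vec (Fin (core + c + k)) t) → Injective _≡_ _≡_ (lookup w) →
      (∀ j → j ∈ᵥ w) → take (core + c) ∘ f ⟪ w ⟫ ≗ h ∘ take (core + c) → K < q ^ k
    reserved-bound w inj all seq
      with stop-at e m w m≤
      where
      -- Every letter occurs in `w`, so all `m + m` core coordinates are pending at the start.
      m≤ : m ≤ ∣ occurring e w ∣
      m≤ = ≤-trans (m≤m+n m m) (≤-trans (≤-reflexive (sym (∣⊤∣≡n core)))
        (p⊆q⇒∣p∣≤∣q∣ {p = ⊤} λ {i} _ → ∈-occurring⁺ e e-injective w (all (e i))))
    -- The word itself selects the half: the core coordinates pending at the stopping time are the
    -- kept ones of `s`.
    ... | stop v w ∣w∣≡m with fromSubset m m (occurring e w) refl ∣w∣≡m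
    ... | s , kept≡ = ≰⇒> collision
      where
      open Reserved K (reserved s)

      disjoint : ∀ {j} → j ∈ᵥ w → j ∉ᵥ v
      disjoint = ++-disjoint v w inj

      -- The content of the additional coordinates at the stopping time. Their initial content is
      -- arbitrary; all `o` is chosen.
      residue : Vec (Fin q) (core + c) → Vec (Fin q) k
      residue x = drop (core + c) (state {h = h} v w disjoint seq (replicate k o) x)

      determined : ∀ {x y} → x ∈ points → y ∈ points → residue x ≡ residue y → x ≡ y
      determined {x} {y} x∈ y∈ eq = target-injective s label≡ (begin
        target s x   ≡⟨ All.lookup on-target x∈ ⟨
        h x          ≡⟨ h-determined v w disjoint seq (replicate k o) x y
                          (λ i i∈ → same-kept s label≡ i (kept-pending i i∈))
                          (λ i i∉ → begin
                            lookup (h x) i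
                              ≡⟨ cong (λ z → lookup z i) (All.lookup on-target x∈) ⟩
                            lookup (target s x) i
                              ≡⟨ same-written s label≡ i (written-done i i∉) ⟩
                            lookup (target s y) i
                              ≡⟨ cong (λ z → lookup z i) (All.lookup on-target y∈) ⟨
                            lookup (h y) i ∎)
                          eq ⟩
        h y          ≡⟨ All.lookup on-target y∈ ⟩
        target s y   ∎)
        where
        open ≡-Reasoning
        label≡ : label s x ≡ label s y
        label≡ = trans (All.lookup same-label x∈) (sym (All.lookup same-label y∈))

        kept-pending : ∀ i → i ↑ˡ k ∈ᵥ w → ∀ j → i ≡ j ↑ˡ c → j ∈ₛ kept s
        kept-pending _ i∈ j refl = subst (j ∈ₛ_) (sym kept≡) (∈-occurring⁺ e e-injective w i∈)

        written-done : ∀ i → i ↑ˡ k ∉ᵥ w → ∀ j → i ≡ j ↑ˡ c → j ∉ₛ kept s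
        written-done _ i∉ j refl j∈ = i∉ (∈-occurring⁻ e w (subst (j ∈ₛ_) kept≡ j∈))

      collision : ¬ q ^ k ≤ K
      collision q^k≤K
        -- Threshold 1: more points than residues force a residue shared by at least two points.
        with pigeonhole _≟ᵥ_ residue (words q k) points (All.tabulate λ _ → ∈-words _) (begin-strict
          1 * length (words q k)   ≡⟨ *-identityˡ _ ⟩
          length (words q k)       ≡⟨ length-words q k ⟩
          q ^ k                    ≤⟨ q^k≤K ⟩
          K                        <⟨ n<1+n K ⟩
          suc K                    ≡⟨ size ⟨
          length points            ∎)
        where open ≤-Reasoning
      ... | r , two with two-distinct (Uniqueₚ.filter⁺ (λ x → residue x ≟ᵥ r) distinct) two
      ... | x , y , x∈ , y∈ , x≢y =
        let x∈points , x≡r = ∈-filter⁻ (λ x → residue x ≟ᵥ r) x∈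
            y∈points , y≡r = ∈-filter⁻ (λ x → residue x ≟ᵥ r) y∈
        in  x≢y (determined x∈points y∈points (trans x≡r (sym y≡r)))

-- Choice of parameters and the final estimate

module _ (q m c : ℕ) (2≤q : 2 ≤ q) (m<c : m < c) where

  private instance
    q≢0 : NonZero q
    q≢0 = >-nonZero (≤-trans (s≤s z≤n) 2≤q)

  -- Halves have size `suc m`, so that `K` can be `q ^ m` without subtraction; the assumption
  -- `m < c` says that `c` is at least this size.
  open Construction (Fin.fromℕ< (≤-trans (s≤s z≤n) 2≤q)) (suc m) c

  -- With `p` equal to `core + c` minus 1, each summand on the left is at most `q ^ p`, and two such
  -- terms fit into `q ^ suc p` because `q` is at least 2.
  enough-points :
    q ^ m * length (words q (suc m + c)) + length (cuts core (suc m) (suc m)) * suc (q ^ m) ≤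
    length (words q (core + c))
  enough-points = begin
    q ^ m * length (words q (suc m + c)) + N * suc (q ^ m)
      ≡⟨ cong (λ l → q ^ m * l + N * suc (q ^ m)) (length-words q (suc m + c)) ⟩
    q ^ m * q ^ (suc m + c) + N * suc (q ^ m)
      ≡⟨ cong (_+ N * suc (q ^ m)) (^-distribˡ-+-* q m (suc m + c)) ⟨
    q ^ p + N * suc (q ^ m)
      ≤⟨ +-monoʳ-≤ (q ^ p) N* ⟩
    q ^ p + q ^ p
      ≡⟨ cong (q ^ p +_) (+-identityʳ (q ^ p)) ⟨
    2 * q ^ p
      ≤⟨ *-monoˡ-≤ (q ^ p) 2≤q ⟩
    q ^ suc p
      ≡⟨ cong (λ l → q ^ suc l) (+-assoc m (suc m) c) ⟨
    q ^ (core + c)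
      ≡⟨ length-words q (core + c) ⟨
    length (words q (core + c)) ∎
    where
    open ≤-Reasoning
    N p : ℕ
    N = length (cuts core (suc m) (suc m))
    p = m + (suc m + c)

    -- Here the outer block must be at least as large as a half, which is the origin of the third in
    -- the bound.
    core+m≤p : core + m ≤ p
    core+m≤p = begin
      core + m              ≡⟨ +-comm core m ⟩
      m + (suc m + suc m)   ≤⟨ +-monoʳ-≤ m (+-monoʳ-≤ (suc m) m<c) ⟩
      p                     ∎

    N* : N * suc (q ^ m) ≤ q ^ p
    N* = begin
      N * suc (q ^ m)                     ≤⟨ *-mono-≤ (length-cuts (m + suc m) (suc m) (suc m))
                                                    (+-monoˡ-≤ (q ^ m) (m^n>0 q m)) ⟩
      2 ^ (m + suc m) * (q ^ m + q ^ m)   ≡⟨ cong (λ l → 2 ^ (m + suc m) * (q ^ m + l)) (+-identityʳ (q ^ m)) ⟨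
      2 ^ (m + suc m) * (2 * q ^ m)       ≡⟨ *-assoc (2 ^ (m + suc m)) 2 (q ^ m) ⟨
      2 ^ (m + suc m) * 2 * q ^ m         ≡⟨ cong (_* q ^ m) (*-comm (2 ^ (m + suc m)) 2) ⟩
      2 ^ core * q ^ m                    ≤⟨ *-monoˡ-≤ (q ^ m) (^-monoˡ-≤ core 2≤q) ⟩
      q ^ core * q ^ m                    ≡⟨ ^-distribˡ-+-* q core m ⟨
      q ^ (core + m)                      ≤⟨ ^-monoʳ-≤ q core+m≤p ⟩
      q ^ p                               ∎

  hard-function : ∃[ h ] suc m ≤ κᵐⁱⁿ {core + c} {q} h
  hard-function with reserve (q ^ m) (cuts core (suc m) (suc m)) enough-points
  ... | h , _ , _ , reserved with κᵐⁱⁿ-isLeast h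
  -- An optimal sequentialization satisfies `q ^ m < q ^ k` for its number `k` of additional
  -- coordinates, which rules out that `k` is at most `m`.
  ... | (f , w , (inj , sur) , seq) , _ = h , ≰⇒> λ κ≤m → <⇒≱
    (reserved-bound (λ s → proj₁ (All.lookup reserved (∈-cuts s))) f w inj
      (λ j → let i , eq = sur j in subst (_∈ᵥ w) (eq refl) (∈-lookup i w)) seq)
    (^-monoʳ-≤ q κ≤m)

mainTheorem5 : (q n : ℕ) → 2 ≤ q → κᵐⁱⁿ[ n , q ] ≥ n / 3
mainTheorem5 q n 2≤q with n / 3 in eq
... | zero  = z≤n
... | suc m = subst (λ n → suc m ≤ κᵐⁱⁿ[ n , q ]) core+r≡n
  (let h , κ≥ = hard-function q m r 2≤q m<r in
   ≤-trans κ≥ (proj₂ (κᵐⁱⁿ[,]-isGreatest (suc m + suc m + r) q) (h , refl)))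
  where
  -- Everything outside two blocks of size `n / 3` goes to the outer block, including the remainder
  -- modulo 3.
  r : ℕ
  r = n ∸ (suc m + suc m)

  three : suc m + suc m + suc m ≤ n
  three = ≤-trans (≤-reflexive (trans (+-assoc (suc m) (suc m) (suc m))
    (trans (cong (λ l → suc m + (suc m + l)) (sym (+-identityʳ (suc m)))) (*-comm 3 (suc m)))))
    (subst (λ l → l * 3 ≤ n) eq (m/n*n≤m n 3))

  m<r : m < r
  m<r = m+n≤o⇒m≤o∸n (suc m) (≤-trans (≤-reflexive (+-comm (suc m) (suc m + suc m))) three)

  core+r≡n : suc m + suc m + r ≡ n
  core+r≡n = m+[n∸m]≡n {suc m + suc m} (≤-trans (m≤m+n _ (suc m)) three)
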